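{- Let $N=(B,E,F)$ be a locally finite, K-dense causal net, let $L(N)$ be its lattice of closed sets, and let $\lambda$ be a line of $N$. Define $\delta_\lambda: L(N)\to\{0,1\}$ by $\delta_\lambda(A)=1$ if $A\cap\lambda\neq\emptyset$, and $\delta_\lambda(A)=0$ otherwise. Then $\delta_\lambda$ is a two-valued state of $L(N)$.
   Context: A net is a triple $N=(B,E,F)$ where $B$ (conditions) and $E$ (events) are countable disjoint sets, $F\subseteq (B\times E)\cup(E\times B)$, and $\mathrm{dom}(F)\cup\mathrm{ran}(F)=B\cup E$. For $x\in B\cup E$ put ${}^\bullet x=\{y : (y,x)\in F\}$ and $x^\bullet=\{y : (x,y)\in F\}$. Let $F^+$ be the transitive closure of $F$ and $F^*$ its reflexive-transitive closure. $N$ is a causal net if every $b\in B$ satisfies $|{}^\bullet b|\le 1$ and $|b^\bullet|\le 1$, and for all $x,y\in B\cup E$, $(x,y)\in F^+$ implies $(y,x)\notin F^+$. Put $X=B\cup E$ and $\sqsubseteq\,=F^*$; then $(X,\sqsubseteq)$ is a partially ordered set. $N$ is locally finite if every interval $[x,y]=\{z : x\sqsubseteq z\sqsubseteq y\}$ is finite and, for all $x\in X$, ${}^\bullet x$ and $x^\bullet$ are finite. Define $\mathbf{li}=\,\sqsubseteq\cup\sqsubseteq^{ -1}$ (comparability) and $\mathbf{co}=(X\times X)\setminus\mathbf{li}$ (concurrency). A line is a maximal set of pairwise $\mathbf{li}$-related elements (maximal chain); a cut is a maximal set of pairwise $\mathbf{co}\cup\mathrm{id}_X$-related elements (maximal antichain).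 $N$ is K-dense if every cut and every line of $(X,\sqsubseteq)$ have non-empty intersection. For $A\subseteq X$ let $A'=\{x\in X : \forall y\in A,\ x\ \mathbf{co}\ y\}$. $A$ is closed if $A=A''$, and $L(N)$ is the family of closed subsets of $X$. Ordered by inclusion, with orthocomplementation $A\mapsto A'$, minimum $\emptyset$ and maximum $X$, $L(N)$ is a complete orthocomplemented (in fact orthomodular) lattice, in which the meet is intersection and the join of a family $(A_i)$ is $(\bigcup_i A_i)''$. Closed sets $A,C$ are orthogonal if $A\subseteq C'$. A two-valued state on $L(N)$ is a map $s:L(N)\to\{0,1\}$ such that, for any sequence $(A_i)_{i\in I}$ of mutually orthogonal elements of $L(N)$ ($A_i\subseteq A_j'$ for $i\ne j$), one has $s(X)=1$ and $s\big(\bigvee_{i\in I}A_i\big)=\sum_{i\in I}s(A_i)$. -}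

module Defs where

open import Axiom.ExcludedMiddle using (ExcludedMiddle)
open import Data.Bool using (if_then_else_)
open import Data.Fin using (Fin; toℕ)
open import Data.Fin.Patterns using (0F; 1F)
open import Data.List using (List; map; sum)
import Data.List.Membership.Propositional as List
import Data.List.Relation.Binary.Subset.Propositional as List
open import Data.List.Relation.Unary.Unique.Propositional using (Unique)
open import Data.Nat using (ℕ)
open import Data.Product using (∃; ∃-syntax; _×_; _,_)
open import Data.Sum using (_⊎_; inj₁; inj₂)
open import Function using (_∘_; _↣_; _⇔_)
open import Level using (0ℓ)
open import Relation.Binary using (Rel)
open import Relation.Binary.Construct.Closure.ReflexiveTransitive using (Star; ε)
open import Relation.Binary.Construct.Closure.Transitive using (TransClosure)
open import Relation.Binary.PropositionalEquality using (_≡_; _≢_)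
open import Relation.Nullary using (¬_; does)
open import Relation.Unary using (Pred; _∈_; _⊆_; _≐_; _≬_; U; ⋃)

-- "Countable" allows finite and empty.
Countable : Set → Set
Countable A = A ↣ ℕ

AtMostOne : {A : Set} → Pred A 0ℓ → Set
AtMostOne S = ∀ {x y} → x ∈ S → y ∈ S → x ≡ y

Finite : {A : Set} → Pred A 0ℓ → Set
Finite S = ∃[ xs ] (∀ x → x ∈ S ⇔ x List.∈ xs)

-- Unconditional summation: the sums over finite sets of indices are
-- eventually v along the directed set of such index sets.  As ℕ is discrete
-- this is convergence of the (possibly infinite) series to v.
HasSum : {I : Set} → (I → ℕ) → ℕ → Set
HasSum {I} f v =
  ∃[ is ] (Unique is × (∀ (js : List I) → Unique js → is List.⊆ js → sum (map f js) ≡ v))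

-- Conditions and events are made disjoint by taking their tagged sum.
record Net : Set₁ where
  field
    B E : Set
    B-countable : Countable B
    E-countable : Countable E

  X : Set
  X = B ⊎ E

  field
    F          : Rel X 0ℓ
    F-no-BB    : ∀ {b c : B} → ¬ F (inj₁ b) (inj₁ c)
    F-no-EE    : ∀ {e f : E} → ¬ F (inj₂ e) (inj₂ f)
    dom∪ran    : ∀ x → (∃[ y ] F x y) ⊎ (∃[ y ] F y x)

open Net using (X)

module _ (N : Net) where
  open Net N using (F; B)

  preset postset : X N → Pred (X N) 0ℓ
  preset  x y = F y x
  postset x y = F x y

  F⁺ F* : Rel (X N) 0ℓ
  F⁺ = TransClosure F
  F* = Star F

  record IsCausalNet : Set where
    field
      preset-≤1  : ∀ (b : B) → AtMostOne (preset (inj₁ b))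
      postset-≤1 : ∀ (b : B) → AtMostOne (postset (inj₁ b))
      acyclic    : ∀ {x y} → F⁺ x y → ¬ F⁺ y x

  Interval : X N → X N → Pred (X N) 0ℓ
  Interval x y z = F* x z × F* z y

  record IsLocallyFinite : Set where
    field
      interval-finite : ∀ x y → Finite (Interval x y)
      preset-finite   : ∀ x → Finite (preset x)
      postset-finite  : ∀ x → Finite (postset x)

  li co : Rel (X N) 0ℓ
  li x y = F* x y ⊎ F* y x
  co x y = ¬ li x y

  Pairwise : Rel (X N) 0ℓ → Pred (X N) 0ℓ → Set
  Pairwise R S = ∀ {x y} → x ∈ S → y ∈ S → R x y

  IsMaximalPairwise : Rel (X N) 0ℓ → Pred (X N) 0ℓ → Set₁
  IsMaximalPairwise R S =
    Pairwise R S × (∀ {T : Pred (X N) 0ℓ} → Pairwise R T → S ⊆ T → T ⊆ S)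

  IsLine IsCut : Pred (X N) 0ℓ → Set₁
  IsLine = IsMaximalPairwise li
  IsCut  = IsMaximalPairwise (λ x y → co x y ⊎ x ≡ y)

  IsKDense : Set₁
  IsKDense = ∀ {c l : Pred (X N) 0ℓ} → IsCut c → IsLine l → c ≬ l

  infixl 12 _′
  _′ : Pred (X N) 0ℓ → Pred (X N) 0ℓ
  (A ′) x = ∀ {y} → y ∈ A → co x y

  IsClosed : Pred (X N) 0ℓ → Set
  IsClosed A = A ≐ A ′ ′

  record ClosedSet : Set₁ where
    field
      set    : Pred (X N) 0ℓ
      closed : IsClosed set

  open ClosedSet

  private
    co-sym : ∀ {x y} → co x y → co y x
    co-sym ¬li (inj₁ p) = ¬li (inj₂ p)
    co-sym ¬li (inj₂ p) = ¬li (inj₁ p)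

    ⊆-″ : ∀ {A} → A ⊆ A ′ ′
    ⊆-″ x∈A y∈A′ = co-sym (y∈A′ x∈A)


  top : ClosedSet
  top .set = U
  top .closed = ⊆-″ {U} , _

  join : {I : Set} → (I → ClosedSet) → ClosedSet
  join {I} A .set = (⋃ I (set ∘ A)) ′ ′
  join {I} A .closed =
    ⊆-″ {(⋃ I (set ∘ A)) ′ ′} , λ x∈S⁗ y∈S′ → x∈S⁗ (⊆-″ {(⋃ I (set ∘ A)) ′} y∈S′)

  Orthogonal : Rel ClosedSet 0ℓ
  Orthogonal A C = set A ⊆ set C ′

  -- Equality of closed sets is extensional, so a map out of L(N) has to
  -- respect _≐_.  A sequence may be finite, empty or infinite.
  record IsTwoValuedState (s : ClosedSet → Fin 2) : Set₁ where
    field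
      respects-≐ : ∀ {A C} → set A ≐ set C → s A ≡ s C
      top-one    : s top ≡ 1F
      additive   : ∀ {I : Set} → Countable I → (A : I → ClosedSet) →
                   (∀ {i j} → i ≢ j → Orthogonal (A i) (A j)) →
                   HasSum (λ i → toℕ (s (A i))) (toℕ (s (join A)))

  -- Excluded middle makes the case distinction defining δ a function.
  δ : ExcludedMiddle 0ℓ → Pred (X N) 0ℓ → ClosedSet → Fin 2
  δ em l A = if does (em {set A ≬ l}) then 1F else 0F

{-# OPTIONS --safe #-}

-- A cut inside ⋃ᵢ Aᵢ ∪ (⋃ᵢ Aᵢ)′ settles additivity: K-density makes it meet
-- the line, and not in (⋃ᵢ Aᵢ)′ once the line meets ⋁ᵢ Aᵢ, hence in some Aᵢ.
-- Countability supplies greedily an antichain M maximal inside that set.  That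
-- M is maximal in X reduces to: what is concurrent with a maximal antichain C
-- of a closed set A is concurrent with A.  Otherwise take a path from such an x
-- to a ∈ A.  As x ∉ A, some z ∈ A′ lies above x, and since conditions do not
-- branch, the next element of the path is again concurrent with C; so a itself
-- is concurrent with C, contradicting maximality of C in A.
module Submission where

open import Defs
open import Axiom.ExcludedMiddle using (ExcludedMiddle)
open import Data.Bool using (if_then_else_)
open import Data.Empty using (⊥; ⊥-elim)
open import Data.Fin using (toℕ)
open import Data.Fin.Patterns using (0F; 1F)
open import Data.List using (List; []; _∷_; map)
import Data.List.Membership.Propositional as List
open import Data.List.Relation.Unary.All as All using (All; []; _∷_)
open import Data.List.Relation.Unary.Any using (here; there)
open import Data.List.Relation.Unary.AllPairs using ([]; _∷_)
open import Data.List.Relation.Unary.Unique.Propositional using (Unique)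
open import Data.Nat using (ℕ; zero; suc; _+_; _*_; _≤′_; ≤′-refl; ≤′-step; _⊔_)
open import Data.Nat.ListAction using (sum)
open import Data.Nat.Properties
  using (+-identityʳ; *-cancelˡ-≡; suc-injective; even≢odd; m≤m⊔n; m≤n⊔m; ≤⇒≤′)
open import Data.Product using (∃-syntax; _×_; _,_; proj₁; proj₂)
open import Data.Sum using (_⊎_; inj₁; inj₂; [_,_]′; swap)
open import Function using (_∘_; flip; _↣_; mk↣; Injection)
open import Level using (0ℓ)
open import Relation.Binary using (Rel)
open import Relation.Binary.Construct.Closure.ReflexiveTransitive
  using (Star; ε; _◅_; _◅◅_; reverse)
open import Relation.Binary.PropositionalEquality
  using (_≡_; _≢_; refl; sym; trans; cong; cong₂; subst)
open import Relation.Nullary using (¬_; yes; no)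
open import Relation.Nullary.Decidable using (dec-true; dec-false)
open import Relation.Unary using (Pred; _∈_; _⊆_; _∪_; _∩_; _≬_; ⋃)

-- Finite sums with at most one non-zero term, and coding of disjoint unions.

sum-map-zero : {I : Set} {f : I → ℕ} {is : List I} →
               All (λ i → f i ≡ 0) is → sum (map f is) ≡ 0
sum-map-zero []       = refl
sum-map-zero (p ∷ ps) = cong₂ _+_ p (sum-map-zero ps)

sum-map-single : {I : Set} {f : I → ℕ} {i : I} → (∀ {j} → i ≢ j → f j ≡ 0) →
                 ∀ {is} → Unique is → i List.∈ is → sum (map f is) ≡ f i
sum-map-single {f = f} {i} f≡0 (i∉is ∷ _) (here refl) =
  trans (cong (f i +_) (sum-map-zero (All.map f≡0 i∉is))) (+-identityʳ (f i))
sum-map-single f≡0 (j∉is ∷ u) (there i∈is) =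
  cong₂ _+_ (f≡0 (All.lookup j∉is i∈is ∘ sym)) (sum-map-single f≡0 u i∈is)

⊎-countable : {A B : Set} → Countable A → Countable B → Countable (A ⊎ B)
⊎-countable {A} {B} f g = mk↣ {to = code} code-injective
  where
  open Injection using (to; injective)

  code : A ⊎ B → ℕ
  code (inj₁ a) = 2 * to f a
  code (inj₂ b) = suc (2 * to g b)

  code-injective : ∀ {x y} → code x ≡ code y → x ≡ y
  code-injective {inj₁ _} {inj₁ _} eq = cong inj₁ (injective f (*-cancelˡ-≡ _ _ 2 eq))
  code-injective {inj₁ a} {inj₂ b} eq = ⊥-elim (even≢odd (to f a) (to g b) eq)
  code-injective {inj₂ b} {inj₁ a} eq = ⊥-elim (even≢odd (to f a) (to g b) (sym eq))
  code-injective {inj₂ _} {inj₂ _} eq =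
    cong inj₂ (injective g (*-cancelˡ-≡ _ _ 2 (suc-injective eq)))

module _ {X : Set} (R : Rel X 0ℓ) where

  -- Every edge of a causal net has this property, since one of its ends is a condition. It is
  -- invariant under reversal of `R`, so it serves both directions of the order.
  Unbranching : Rel X 0ℓ
  Unbranching x y = (∀ {z} → R x z → z ≡ y) ⊎ (∀ {z} → R z y → z ≡ x)

  unique-successor : ∀ {x y z} → (∀ {w} → R x w → w ≡ y) →
                     Star R x z → x ≡ z ⊎ Star R y z
  unique-successor u ε = inj₁ refl
  unique-successor u (e ◅ p) with refl ← u e = inj₂ p

  unique-predecessor : ∀ {x y z} → (∀ {w} → R w y → w ≡ x) →
                       Star R z y → z ≡ y ⊎ Star R z x
  unique-predecessor u ε = inj₁ refl
  unique-predecessor u (e ◅ p) with unique-predecessor u p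
  ... | inj₂ q = inj₂ (e ◅ q)
  ... | inj₁ refl with refl ← u e = inj₂ ε

module _ (N : Net) where
  open Net N using (X; F; B-countable; E-countable)
  open ClosedSet

  infixl 12 _ᶜᵒ
  _ᶜᵒ : Pred X 0ℓ → Pred X 0ℓ
  _ᶜᵒ = _′ N

  co-sym : ∀ {x y} → co N x y → co N y x
  co-sym x∥y = x∥y ∘ swap

  co-irrefl : ∀ {x} → ¬ co N x x
  co-irrefl x∥x = x∥x (inj₁ ε)

  -- R is F or its converse, so that only one of the two symmetric cases of
  -- comparability has to be treated.
  module _ (R : Rel X 0ℓ)
           (unbranching : ∀ {x y} → R x y → Unbranching R x y)
           (co⇒≰ : ∀ {x y} → co N x y → ¬ Star R x y)
           (≰⇒co : ∀ {x y} → ¬ Star R x y → ¬ Star R y x → co N x y)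
           where

    -- Suppose some `c` in `C` lies below `y`. If `y` is the only successor of `x`, the path to `z`
    -- is empty, putting `z` below `a`, or passes through `y`, putting `c` below `z`; both
    -- contradict `z ∈ A ᶜᵒ`. If `x` is the only predecessor of `y`, then `c` is `y` or lies below
    -- `x`, against `x ∈ C ᶜᵒ`.
    co-step : ∀ {A C : Pred X 0ℓ} {x y z a} → C ⊆ A → z ∈ A ᶜᵒ → Star R x z →
              R x y → Star R y a → a ∈ A → x ∈ C ᶜᵒ → y ∈ C ᶜᵒ
    co-step {A} {C} {x} {y} {z} {a} C⊆A z∈A′ x≤z e y≤a a∈A x∈C′ {c} c∈C =
      ≰⇒co (λ y≤c → co⇒≰ (x∈C′ c∈C) (e ◅ y≤c)) c≰y
      where
      c≰y : ¬ Star R c y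
      c≰y c≤y with unbranching e
      ... | inj₁ succ with unique-successor R succ x≤z
      ...   | inj₁ refl = co⇒≰ (z∈A′ a∈A) (e ◅ y≤a)
      ...   | inj₂ y≤z  = co⇒≰ (co-sym (z∈A′ (C⊆A c∈C))) (c≤y ◅◅ y≤z)
      c≰y c≤y | inj₂ pred with unique-predecessor R pred c≤y
      ...   | inj₁ refl = co⇒≰ (x∈C′ c∈C) (e ◅ ε)
      ...   | inj₂ c≤x  = co⇒≰ (co-sym (x∈C′ c∈C)) c≤x

    co-maximal⇒≰ : ∀ {A C : Pred X 0ℓ} {x a} → IsClosed N A → C ⊆ A →
                   (∀ {y} → y ∈ A → ¬ y ∈ C ᶜᵒ) →
                   a ∈ A → x ∈ C ᶜᵒ → ¬ Star R x a
    co-maximal⇒≰ closed C⊆A maximal a∈A x∈C′ ε = maximal a∈A x∈C′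
    co-maximal⇒≰ {A} {C} {x} closed C⊆A maximal a∈A x∈C′ (e ◅ y≤a) =
      maximal (proj₂ closed x∈A″) x∈C′
      where
      x∈A″ : x ∈ A ᶜᵒ ᶜᵒ
      -- A `z` above `x` allows the step to `y` and recursion on the shorter path; a `z` below `x`
      -- would lie below `a`.
      x∈A″ z∈A′ = ≰⇒co
        (λ x≤z → co-maximal⇒≰ {A} {C} closed C⊆A maximal a∈A
                   (co-step {A} {C} C⊆A z∈A′ x≤z e y≤a a∈A x∈C′) y≤a)
        (λ z≤x → co⇒≰ (z∈A′ a∈A) (z≤x ◅◅ e ◅ y≤a))

  module _ (causal : IsCausalNet N) where
    open IsCausalNet causal

    F-unbranching : ∀ {x y} → F x y → Unbranching F x y
    F-unbranching {inj₁ b} {_} e = inj₁ (λ e′ → postset-≤1 b e′ e)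
    F-unbranching {inj₂ _} {inj₁ b} e = inj₂ (λ e′ → preset-≤1 b e′ e)
    F-unbranching {inj₂ _} {inj₂ _} e = ⊥-elim (Net.F-no-EE N e)

    maximal-antichain-′ : ∀ {A C : Pred X 0ℓ} → IsClosed N A → C ⊆ A →
                          (∀ {y} → y ∈ A → ¬ y ∈ C ᶜᵒ) → C ᶜᵒ ⊆ A ᶜᵒ
    maximal-antichain-′ {A} {C} closed C⊆A maximal x∈C′ a∈A =
      [ co-maximal⇒≰ F F-unbranching
          (λ x∥y → x∥y ∘ inj₁)
          (λ x≰y y≰x → [ x≰y , y≰x ]′)
          {A} {C} closed C⊆A maximal a∈A x∈C′
      , co-maximal⇒≰ (flip F) (swap ∘ F-unbranching)
          (λ x∥y → x∥y ∘ inj₂ ∘ converse)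
          (λ x≰y y≰x → [ y≰x ∘ converse , x≰y ∘ converse ]′)
          {A} {C} closed C⊆A maximal a∈A x∈C′ ∘ converse
      ]′
      where
      converse : {R : Rel X 0ℓ} → ∀ {x y} → Star R x y → Star (flip R) y x
      converse = reverse (λ e → e)

  -- A greedy maximal antichain of a set.

  module Greedy (S : Pred X 0ℓ) where
    open Injection (⊎-countable B-countable E-countable)
      using () renaming (to to code; injective to code-injective)

    -- `Stage n` holds the chosen elements with code below `n`. Since `code` is injective, each step
    -- adds at most one element.
    Stage : ℕ → Pred X 0ℓ
    Stage zero    x = ⊥
    Stage (suc n) x = Stage n x ⊎ (code x ≡ n × x ∈ S × x ∈ Stage n ᶜᵒ)

    antichain : Pred X 0ℓ
    antichain x = ∃[ n ] Stage n x

    Stage-mono : ∀ {m n} → m ≤′ n → Stage m ⊆ Stage n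
    Stage-mono ≤′-refl       = λ x∈Sₘ → x∈Sₘ
    Stage-mono (≤′-step m≤n) = inj₁ ∘ Stage-mono m≤n

    Stage-pairwise : ∀ n → Pairwise N (λ x y → co N x y ⊎ x ≡ y) (Stage n)
    Stage-pairwise (suc n) (inj₁ p) (inj₁ q) = Stage-pairwise n p q
    Stage-pairwise (suc n) (inj₁ p) (inj₂ (_ , _ , y∥)) = inj₁ (co-sym (y∥ p))
    Stage-pairwise (suc n) (inj₂ (_ , _ , x∥)) (inj₁ q) = inj₁ (x∥ q)
    Stage-pairwise (suc n) (inj₂ (p , _)) (inj₂ (q , _)) =
      inj₂ (code-injective (trans p (sym q)))

    antichain-pairwise : Pairwise N (λ x y → co N x y ⊎ x ≡ y) antichain
    antichain-pairwise (m , p) (n , q) = Stage-pairwise (m ⊔ n)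
      (Stage-mono (≤⇒≤′ (m≤m⊔n m n)) p) (Stage-mono (≤⇒≤′ (m≤n⊔m m n)) q)

    antichain⊆S : antichain ⊆ S
    antichain⊆S (suc n , inj₁ p)             = antichain⊆S (n , p)
    antichain⊆S (suc n , inj₂ (_ , x∈S , _)) = x∈S

    -- An `x` concurrent with the whole antichain is concurrent with `Stage (code x)`, so it was
    -- chosen at its own turn and would be concurrent with itself.
    antichain-maximal : ∀ {x} → x ∈ S → ¬ x ∈ antichain ᶜᵒ
    antichain-maximal {x} x∈S x∥ = co-irrefl
      (x∥ (suc (code x) , inj₂ (refl , x∈S , λ y∈ → x∥ (code x , y∈))))

  -- Cuts adapted to an orthogonal family.

  module _ (em : ExcludedMiddle 0ℓ) where

    antichain⇒cut : ∀ {M : Pred X 0ℓ} → Pairwise N (λ x y → co N x y ⊎ x ≡ y) M →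
                    (∀ {x} → ¬ x ∈ M ᶜᵒ) → IsCut N M
    antichain⇒cut {M} pairwise maximal = pairwise , extend
      where
      extend : ∀ {T : Pred X 0ℓ} → Pairwise N (λ x y → co N x y ⊎ x ≡ y) T →
               M ⊆ T → T ⊆ M
      extend T-pairwise M⊆T {x} x∈T with em {x ∈ M}
      ... | yes x∈M = x∈M
      ... | no  x∉M = ⊥-elim (maximal λ y∈M →
        [ (λ x∥y → x∥y)
        , (λ x≡y → ⊥-elim (x∉M (subst M (sym x≡y) y∈M)))
        ]′ (T-pairwise x∈T (M⊆T y∈M)))

    cut-in-orthogonal-family :
      IsCausalNet N → {I : Set} (A : I → ClosedSet N) →
      (∀ {i j} → i ≢ j → Orthogonal N (A i) (A j)) →
      let V = ⋃ I (set ∘ A) in ∃[ c ] (IsCut N c × c ⊆ V ∪ V ᶜᵒ)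
    cut-in-orthogonal-family causal {I} A orthogonal =
      antichain , antichain⇒cut antichain-pairwise maximal , antichain⊆S
      where
      V : Pred X 0ℓ
      V = ⋃ I (set ∘ A)
      open Greedy (V ∪ V ᶜᵒ)

      maximal-in : ∀ i {x} → x ∈ set (A i) → ¬ x ∈ (antichain ∩ set (A i)) ᶜᵒ
      maximal-in i {x} x∈Aᵢ x∥ = antichain-maximal (inj₁ (i , x∈Aᵢ)) x∥antichain
        where
        x∥antichain : x ∈ antichain ᶜᵒ
        -- Elements of the antichain outside `A i` lie in `V ᶜᵒ` or in another member of the family,
        -- hence are concurrent with `x` anyway.
        x∥antichain y∈M with antichain⊆S y∈M
        ... | inj₂ y∈V′ = co-sym (y∈V′ (i , x∈Aᵢ))
        ... | inj₁ (j , y∈Aⱼ) with em {i ≡ j}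
        ...   | yes refl = x∥ (y∈M , y∈Aⱼ)
        ...   | no i≢j   = orthogonal i≢j x∈Aᵢ y∈Aⱼ

      maximal : ∀ {x} → ¬ x ∈ antichain ᶜᵒ
      -- Concurrency with each trace on `A i` gives concurrency with all of `A i`, so `x` lies in
      -- `V ᶜᵒ`, where the antichain is already maximal.
      maximal x∥ = antichain-maximal
        (inj₂ λ (i , y∈Aᵢ) →
          maximal-antichain-′ causal {C = antichain ∩ set (A i)} (closed (A i)) proj₂
            (maximal-in i) (x∥ ∘ proj₁) y∈Aᵢ)
        x∥

    -- The state given by a line.

    module _ (l : Pred X 0ℓ) where

      δ-meets : ∀ {A} → set A ≬ l → δ N em l A ≡ 1F
      δ-meets p = cong (if_then 1F else 0F) (dec-true em p)

      δ-misses : ∀ {A} → ¬ set A ≬ l → δ N em l A ≡ 0F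
      δ-misses ¬p = cong (if_then 1F else 0F) (dec-false em ¬p)

      module _ (causal : IsCausalNet N) (K-dense : IsKDense N) (line : IsLine N l) where

        -- The empty family already yields some cut, and K-density makes the line meet it.
        line-nonempty : ∃[ x ] x ∈ l
        line-nonempty with _ , cut , _ ← cut-in-orthogonal-family causal {⊥} (λ ()) (λ { {()} })
                      with x , _ , x∈l ← K-dense cut line = x , x∈l

        join-meets : {I : Set} (A : I → ClosedSet N) →
                     (∀ {i j} → i ≢ j → Orthogonal N (A i) (A j)) →
                     set (join N A) ≬ l → ∃[ i ] set (A i) ≬ l
        join-meets A orthogonal (x , x∈V″ , x∈l)
          with c , cut , c⊆ ← cut-in-orthogonal-family causal A orthogonal
          with y , y∈c , y∈l ← K-dense {c} cut line
          with c⊆ y∈c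
        ... | inj₁ (i , y∈Aᵢ) = i , y , y∈Aᵢ , y∈l
        -- Here `x` and `y` would be concurrent, yet both lie on the line.
        ... | inj₂ y∈V′       = ⊥-elim (x∈V″ y∈V′ (proj₁ line x∈l y∈l))

        join-met : {I : Set} (A : I → ClosedSet N) → ∀ {i} →
                   set (A i) ≬ l → set (join N A) ≬ l
        join-met A {i} (x , x∈Aᵢ , x∈l) = x , (λ y∈V′ → co-sym (y∈V′ (i , x∈Aᵢ))) , x∈l

        orthogonal-misses : ∀ {A C} → Orthogonal N A C → set A ≬ l → ¬ set C ≬ l
        orthogonal-misses A⊥C (x , x∈A , x∈l) (y , y∈C , y∈l) =
          A⊥C x∈A y∈C (proj₁ line x∈l y∈l)

        δ-isTwoValuedState : IsTwoValuedState N (δ N em l)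
        δ-isTwoValuedState .IsTwoValuedState.respects-≐ {A} {C} (A⊆C , C⊆A) with em {set A ≬ l}
        ... | yes (x , x∈A , x∈l) = sym (δ-meets {C} (x , A⊆C x∈A , x∈l))
        ... | no ¬p = sym (δ-misses {C} λ (x , x∈C , x∈l) → ¬p (x , C⊆A x∈C , x∈l))
        δ-isTwoValuedState .IsTwoValuedState.top-one
          with x , x∈l ← line-nonempty = δ-meets {top N} (x , _ , x∈l)
        δ-isTwoValuedState .IsTwoValuedState.additive {I} _ A orthogonal
          with em {∃[ i ] set (A i) ≬ l}
        -- By orthogonality no other member meets the line, so every finite index set containing `i`
        -- has sum 1.
        ... | yes (i , p) = i ∷ [] , [] ∷ [] , λ js unique i⊆js →
          trans (sum-map-single
                  (λ {j} i≢j → cong toℕ (δ-misses {A j}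
                    (orthogonal-misses {A i} {A j} (orthogonal i≢j) p)))
                  unique (i⊆js (here refl)))
                (cong toℕ (trans (δ-meets {A i} p) (sym (δ-meets {join N A} (join-met A p)))))
        -- All terms vanish, so the sums are 0 from the empty index set on.
        ... | no ¬p = [] , [] , λ js _ _ →
          trans (sum-map-zero (All.universal
                  (λ i → cong toℕ (δ-misses {A i} (λ q → ¬p (i , q)))) js))
                (cong toℕ (sym (δ-misses {join N A} (¬p ∘ join-meets A orthogonal))))

theorem2 : (em : ExcludedMiddle 0ℓ) (N : Net) →
    IsCausalNet N → IsLocallyFinite N → IsKDense N →
    (l : Pred (Net.X N) 0ℓ) → IsLine N l →
    IsTwoValuedState N (δ N em l)
theorem2 em N causal _ K-dense l line = δ-isTwoValuedState N em l causal K-dense line
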